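{- Let $Q$ be a skew symmetric core of order $q$. Then for each integer $m\ge0$ the matrices $\mathcal{J}^{(q)}_m$ and $\mathcal{A}^{(q)}_m$ constructed from $Q$ are a pair of amicable $(\pm1)$-matrices satisfying $$\mathcal{J}^{(q)}_m\left(\mathcal{J}^{(q)}_m\right)^T+q\,\mathcal{A}^{(q)}_m\left(\mathcal{A}^{(q)}_m\right)^T=q^m(q+1)I_{q^m}.$$
   Context: A Hadamard matrix of order $n$ is an $n\times n$ $(\pm1)$-matrix $H$ with $HH^T=nI_n$; it is of skew type if $H=I+W$ with $W$ a skew symmetric $(0,\pm1)$-matrix. A skew symmetric core of order $q$ is a $q\times q$ matrix $Q$ such that $\begin{pmatrix}1 & j\\ -j^T & I+Q\end{pmatrix}$ is a skew type Hadamard matrix of order $q+1$, where $j$ is the $1\times q$ all-ones matrix. Such $Q$ is a skew symmetric $(0,\pm1)$-matrix with $J_qQ=QJ_q=0$ and $QQ^T=qI_q-J_q$, where $J_n$ denotes the $n\times n$ all-ones matrix. Given $Q$, define recursively $\mathcal{J}^{(q)}_0=\mathcal{A}^{(q)}_0=J_1$ and, for $m\ge1$, $\mathcal{J}^{(q)}_m=J_q\otimes\mathcal{A}^{(q)}_{m-1}$, $\mathcal{A}^{(q)}_m=I_q\otimes\mathcal{J}^{(q)}_{m-1}+Q\otimes\mathcal{A}^{(q)}_{m-1}$. Two complex matrices $A,B$ are amicable if $AB^*=BA^*$ (for real matrices, $AB^T=BA^T$). A $(\pm1)$-matrix is a matrix with all entries in $\{1,-1\}$. -}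

module Defs where

open import Data.Bool.Base using (if_then_else_)
open import Data.Fin.Base using (Fin; remQuot)
open import Data.Fin.Properties using (_≟_)
open import Data.Integer.Base using (ℤ; +_; -_; _+_; _*_; 0ℤ; 1ℤ; -1ℤ)
open import Data.Integer.Properties using (+-*-semiring)
open import Data.Nat.Base as ℕ using (ℕ; zero; suc)
open import Data.Product.Base using (∃; _×_; proj₁; proj₂)
open import Data.Sum.Base using (_⊎_)
open import Data.Vec.Functional using (Vector; transpose; zipWith; _++_)
open import Relation.Binary.PropositionalEquality using (_≡_)
open import Relation.Nullary.Decidable.Core using (does)
open import Algebra.Properties.Semiring.Sum +-*-semiring using (sum)

infix  4 _≈ₘ_
infixl 6 _+ₘ_
infixl 7 _*ₘ_ _⊗_
infixr 8 _·_
infix  9 -ₘ_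
infix 10 _ᵀ

-- Every matrix considered here has entries in {0, 1, -1} or is obtained from
-- such matrices by ring operations, so matrices are taken over ℤ.
Matrix : ℕ → ℕ → Set
Matrix m n = Vector (Vector ℤ n) m

-- Entrywise, since propositional equality of functions is too strict.
_≈ₘ_ : ∀ {m n} → Matrix m n → Matrix m n → Set
A ≈ₘ B = ∀ i j → A i j ≡ B i j

_ᵀ : ∀ {m n} → Matrix m n → Matrix n m
_ᵀ = transpose

_+ₘ_ : ∀ {m n} → Matrix m n → Matrix m n → Matrix m n
(A +ₘ B) i j = A i j + B i j

-ₘ_ : ∀ {m n} → Matrix m n → Matrix m n
(-ₘ A) i j = - A i j

_·_ : ∀ {m n} → ℤ → Matrix m n → Matrix m n
(c · A) i j = c * A i j

_*ₘ_ : ∀ {l m n} → Matrix l m → Matrix m n → Matrix l n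
(A *ₘ B) i j = sum (λ k → A i k * B k j)

-- remQuot p is the inverse of (a , b) ↦ a p + b, so the left factor indexes
-- the blocks.
_⊗_ : ∀ {m n p r} → Matrix m n → Matrix p r → Matrix (m ℕ.* p) (n ℕ.* r)
_⊗_ {m} {n} {p} {r} A B i j =
  A (proj₁ (remQuot {m} p i)) (proj₁ (remQuot {n} r j)) *
  B (proj₂ (remQuot {m} p i)) (proj₂ (remQuot {n} r j))

I : ∀ n → Matrix n n
I n i j = if does (i ≟ j) then 1ℤ else 0ℤ

ones : ∀ m n → Matrix m n
ones m n i j = 1ℤ

J : ∀ n → Matrix n n
J n = ones n n

blocks : ∀ {m₁ m₂ n₁ n₂} →
         Matrix m₁ n₁ → Matrix m₁ n₂ →
         Matrix m₂ n₁ → Matrix m₂ n₂ →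
         Matrix (m₁ ℕ.+ m₂) (n₁ ℕ.+ n₂)
blocks A B C D = zipWith _++_ A B ++ zipWith _++_ C D

PlusMinusOne : ∀ {m n} → Matrix m n → Set
PlusMinusOne A = ∀ i j → A i j ≡ 1ℤ ⊎ A i j ≡ -1ℤ

ZeroPlusMinusOne : ∀ {m n} → Matrix m n → Set
ZeroPlusMinusOne A = ∀ i j → A i j ≡ 0ℤ ⊎ A i j ≡ 1ℤ ⊎ A i j ≡ -1ℤ

SkewSymmetric : ∀ {n} → Matrix n n → Set
SkewSymmetric A = A ᵀ ≈ₘ -ₘ A

-- For integer matrices the conjugate transpose is the transpose.
Amicable : ∀ {m n} → Matrix m n → Matrix m n → Set
Amicable A B = A *ₘ B ᵀ ≈ₘ B *ₘ A ᵀ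

record Hadamard {n : ℕ} (H : Matrix n n) : Set where
  field
    plusMinusOne : PlusMinusOne H
    orthogonal   : H *ₘ H ᵀ ≈ₘ (+ n) · I n

record SkewTypeHadamard {n : ℕ} (H : Matrix n n) : Set where
  field
    hadamard : Hadamard H
    skewType : ∃ λ (W : Matrix n n) →
               ZeroPlusMinusOne W × SkewSymmetric W × H ≈ₘ I n +ₘ W

SkewSymmetricCore : ∀ {q} → Matrix q q → Set
SkewSymmetricCore {q} Q =
  SkewTypeHadamard (blocks (I 1)    j
                           (-ₘ j ᵀ) (I q +ₘ Q))
  where
  j : Matrix 1 q
  j = ones 1 q

mutual
  𝒥 : ∀ {q} → Matrix q q → (m : ℕ) → Matrix (q ℕ.^ m) (q ℕ.^ m)
  𝒥     Q zero    = J 1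
  𝒥 {q} Q (suc m) = J q ⊗ 𝒜 Q m

  𝒜 : ∀ {q} → Matrix q q → (m : ℕ) → Matrix (q ℕ.^ m) (q ℕ.^ m)
  𝒜     Q zero    = J 1
  𝒜 {q} Q (suc m) = I q ⊗ 𝒥 Q m +ₘ Q ⊗ 𝒜 Q m

{-# OPTIONS --safe #-}

-- A core satisfies Qᵀ = −Q, QJ = 0 and QQᵀ = qI − J, all read off the blocks of
-- HHᵀ = (q+1)I.  By the mixed-product rule, one step of the recursion sends an
-- amicable pair X, Y to X′ = J ⊗ Y and Y′ = I ⊗ X + Q ⊗ Y, with
--   X′X′ᵀ = qJ ⊗ YYᵀ,   X′Y′ᵀ = J ⊗ YXᵀ,   Y′Y′ᵀ = I ⊗ XXᵀ + (qI − J) ⊗ YYᵀ,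
-- where the cross terms Q ⊗ YXᵀ + Qᵀ ⊗ XYᵀ of Y′Y′ᵀ cancel by amicability.
-- Hence X′X′ᵀ + q Y′Y′ᵀ = qI ⊗ (XXᵀ + q YYᵀ).
module Submission where

open import Defs
open import Algebra.Bundles using (module AbelianGroup)
open import Algebra.Properties.Group using (∙-cancelˡ)
open import Data.Fin.Base using (Fin; zero; suc; _↑ˡ_; _↑ʳ_; combine; quotient; remainder)
open import Data.Fin.Properties using (_≟_; remQuot-combine; combine-remQuot)
open import Data.Integer.Base as ℤ using (ℤ; +_; 0ℤ; 1ℤ; -1ℤ)
import Data.Integer.Properties as ℤ
open import Data.Integer.Tactic.RingSolver using (solve-∀)
open import Data.Nat.Base using (ℕ; zero; suc; _+_; _*_; _^_)
import Data.Nat.Properties as ℕ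
open import Data.Product.Base using (_×_; _,_; proj₁; proj₂; uncurry)
open import Data.Sum.Base using (_⊎_; inj₁; inj₂)
open import Data.Vec.Functional using (Vector)
open import Function.Base using (_∘_)
open import Relation.Binary.PropositionalEquality hiding (J)
open import Relation.Nullary.Decidable using (yes; no; dec-true; dec-false)
open import Algebra.Properties.Semiring.Sum ℤ.+-*-semiring
  using (sum; sum-cong-≗; sum-replicate-zero; ∑-distrib-+; *-distribˡ-sum; *-distribʳ-sum)

open ≡-Reasoning

private
  variable
    k l m n p r s : ℕ

-- Finite sums

sum-++ : ∀ m (f : Vector ℤ (m + n)) → sum f ≡ sum (f ∘ (_↑ˡ n)) ℤ.+ sum (f ∘ (m ↑ʳ_))
sum-++ zero    f = sym (ℤ.+-identityˡ _)
sum-++ (suc m) f = trans (cong (λ x → f zero ℤ.+ x) (sum-++ m (f ∘ suc))) (sym (ℤ.+-assoc (f zero) _ _))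

sum-combine : ∀ m (f : Vector ℤ (m * n)) → sum f ≡ sum {m} (λ a → sum (λ b → f (combine a b)))
sum-combine         zero    f = refl
sum-combine {n = n} (suc m) f =
  trans (sum-++ n f) (cong (λ x → sum (f ∘ (_↑ˡ (m * n))) ℤ.+ x) (sum-combine m (f ∘ (n ↑ʳ_))))

-- Reindexing along `combine`, the inverse of `remQuot`, gives a double sum whose summand separates
-- into a factor for each index. The mixed-product rule rests on this.
sum-remQuot : ∀ (f : Vector ℤ m) (g : Vector ℤ n) →
              sum (λ i → f (quotient n i) ℤ.* g (remainder {m} n i)) ≡ sum f ℤ.* sum g
sum-remQuot {m} {n} f g = begin
  sum (λ i → f (quotient n i) ℤ.* g (remainder {m} n i))
    ≡⟨ sum-combine m (λ i → f (quotient n i) ℤ.* g (remainder {m} n i)) ⟩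
  sum (λ a → sum (λ b → f (quotient n (combine {m} {n} a b)) ℤ.* g (remainder {m} n (combine a b))))
    ≡⟨ sum-cong-≗ (λ a → sum-cong-≗ (λ b →
         cong (uncurry λ c d → f c ℤ.* g d) (remQuot-combine a b))) ⟩
  sum (λ a → sum (λ b → f a ℤ.* g b))
    ≡⟨ sum-cong-≗ (λ a → *-distribˡ-sum (f a) g) ⟨
  sum (λ a → f a ℤ.* sum g)
    ≡⟨ *-distribʳ-sum (sum g) f ⟨
  sum f ℤ.* sum g ∎

sum-ones : ∀ n → sum {n} (λ _ → 1ℤ) ≡ + n
sum-ones zero    = refl
sum-ones (suc n) = cong (λ x → 1ℤ ℤ.+ x) (sum-ones n)

sum-I : ∀ (i : Fin n) (f : Vector ℤ n) → sum (λ k → I n i k ℤ.* f k) ≡ f i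
sum-I {suc n} zero f = begin
  1ℤ ℤ.* f zero ℤ.+ sum {n} (λ _ → 0ℤ) ≡⟨ cong₂ ℤ._+_ (ℤ.*-identityˡ (f zero)) (sum-replicate-zero n) ⟩
  f zero ℤ.+ 0ℤ                        ≡⟨ ℤ.+-identityʳ _ ⟩
  f zero                               ∎
sum-I (suc i) f = trans (ℤ.+-identityˡ _) (sum-I i (f ∘ suc))

-- Matrix algebra

I-diag : ∀ (i : Fin n) → I n i i ≡ 1ℤ
I-diag i rewrite dec-true (i ≟ i) refl = refl

I-off-diag : ∀ {i j : Fin n} → i ≢ j → I n i j ≡ 0ℤ
I-off-diag {i = i} {j} i≢j rewrite dec-false (i ≟ j) i≢j = refl

-- Two indices are equal exactly when their quotients and their remainders are. Deciding both
-- equalities makes the right side compute, so each case only has to evaluate `I (m * n) i j`.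
I-⊗-I : I (m * n) ≈ₘ I m ⊗ I n
I-⊗-I {m} {n} i j with quotient {m} n i ≟ quotient {m} n j | remainder {m} n i ≟ remainder {m} n j
... | yes a≡c | yes b≡d = trans (cong (I (m * n) i) (sym i≡j)) (I-diag i)
  where
  i≡j : i ≡ j
  i≡j = trans (sym (combine-remQuot {m} n i)) (trans (cong₂ combine a≡c b≡d) (combine-remQuot {m} n j))
... | yes _   | no b≢d  = I-off-diag (b≢d ∘ cong (remainder {m} n))
... | no a≢c  | yes _   = I-off-diag (a≢c ∘ cong (quotient {m} n))
... | no a≢c  | no _    = I-off-diag (a≢c ∘ cong (quotient {m} n))

*ₘ-identityˡ : ∀ (A : Matrix m n) → I m *ₘ A ≈ₘ A
*ₘ-identityˡ A i j = sum-I i (λ k → A k j)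

-- The transpose is kept because the identity arises in this form when a product `A *ₘ B ᵀ` is
-- expanded; column `j` of `I n ᵀ` is row `j` of `I n`, which is the form `sum-I` takes.
*ₘ-identityʳ-ᵀ : ∀ (A : Matrix m n) → A *ₘ I n ᵀ ≈ₘ A
*ₘ-identityʳ-ᵀ A i j = trans (sum-cong-≗ (λ k → ℤ.*-comm (A i k) _)) (sum-I j (A i))

*ₘ-distribˡ-+ₘ : ∀ (A : Matrix l m) (B C : Matrix m n) → A *ₘ (B +ₘ C) ≈ₘ A *ₘ B +ₘ A *ₘ C
*ₘ-distribˡ-+ₘ A B C i j =
  trans (sum-cong-≗ (λ k → ℤ.*-distribˡ-+ (A i k) (B k j) (C k j)))
        (∑-distrib-+ (λ k → A i k ℤ.* B k j) (λ k → A i k ℤ.* C k j))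

*ₘ-distribʳ-+ₘ : ∀ (A B : Matrix l m) (C : Matrix m n) → (A +ₘ B) *ₘ C ≈ₘ A *ₘ C +ₘ B *ₘ C
*ₘ-distribʳ-+ₘ A B C i j =
  trans (sum-cong-≗ (λ k → ℤ.*-distribʳ-+ (C k j) (A i k) (B i k)))
        (∑-distrib-+ (λ k → A i k ℤ.* C k j) (λ k → B i k ℤ.* C k j))

*ₘ-expand : ∀ (A B : Matrix l m) (C D : Matrix m n) →
            (A +ₘ B) *ₘ (C +ₘ D) ≈ₘ (A *ₘ C +ₘ A *ₘ D) +ₘ (B *ₘ C +ₘ B *ₘ D)
*ₘ-expand A B C D i j =
  trans (*ₘ-distribʳ-+ₘ A B (C +ₘ D) i j)
        (cong₂ ℤ._+_ (*ₘ-distribˡ-+ₘ A C D i j) (*ₘ-distribˡ-+ₘ B C D i j))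

-- By this, `A` and `B` are amicable exactly when `A *ₘ B ᵀ` is symmetric.
*ₘ-ᵀ-swap : ∀ (A : Matrix l m) (B : Matrix n m) → A *ₘ B ᵀ ≈ₘ (B *ₘ A ᵀ) ᵀ
*ₘ-ᵀ-swap A B i j = sum-cong-≗ (λ k → ℤ.*-comm (A i k) (B j k))

⊗-*ₘ-⊗ : ∀ (A : Matrix k l) (B : Matrix p r) (C : Matrix l m) (D : Matrix r s) →
         (A ⊗ B) *ₘ (C ⊗ D) ≈ₘ (A *ₘ C) ⊗ (B *ₘ D)
⊗-*ₘ-⊗ {k = k} {l} {p} {r} {m} {s} A B C D i j =
  -- Each summand is regrouped into an `A`, `C` factor depending on the quotient of the summation
  -- index and a `B`, `D` factor depending on its remainder.
  trans (sum-cong-≗ {l * r} (λ x → swap (A a _) (B b _) (C _ c) (D _ d)))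
        (sum-remQuot {l} {r} (λ x → A a x ℤ.* C x c) (λ y → B b y ℤ.* D y d))
  where
  a = quotient {k} p i
  b = remainder {k} p i
  c = quotient {m} s j
  d = remainder {m} s j
  swap : ∀ w x y z → (w ℤ.* x) ℤ.* (y ℤ.* z) ≡ (w ℤ.* y) ℤ.* (x ℤ.* z)
  swap = solve-∀

-- Signs

IsSign : ℤ → Set
IsSign x = x ≡ 1ℤ ⊎ x ≡ -1ℤ

*-isSign : ∀ {x y} → IsSign x → IsSign y → IsSign (x ℤ.* y)
*-isSign (inj₁ refl) (inj₁ refl) = inj₁ refl
*-isSign (inj₁ refl) (inj₂ refl) = inj₂ refl
*-isSign (inj₂ refl) (inj₁ refl) = inj₂ refl
*-isSign (inj₂ refl) (inj₂ refl) = inj₁ refl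

-- Skew symmetric cores

module Core {q : ℕ} (Q : Matrix q q) (core : SkewSymmetricCore Q) where
  open SkewTypeHadamard core
  open Hadamard hadamard

  private
    W = proj₁ skewType

    Q≡W : ∀ i j → Q i j ≡ W (suc i) (suc j)
    Q≡W i j = ∙-cancelˡ (AbelianGroup.group ℤ.+-0-abelianGroup) (I q i j) _ _
                        (proj₂ (proj₂ (proj₂ skewType)) (suc i) (suc j))

  Q-skew : SkewSymmetric Q
  Q-skew i j = begin
    Q j i                     ≡⟨ Q≡W j i ⟩
    W (suc j) (suc i)         ≡⟨ proj₁ (proj₂ (proj₂ skewType)) (suc i) (suc j) ⟩
    ℤ.- W (suc i) (suc j)     ≡⟨ cong ℤ.-_ (Q≡W i j) ⟨
    ℤ.- Q i j                 ∎

  Q-diag : ∀ i → Q i i ≡ 0ℤ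
  Q-diag i = x≡-x⇒x≡0 (Q-skew i i)
    where
    x≡-x⇒x≡0 : ∀ {x} → x ≡ ℤ.- x → x ≡ 0ℤ
    -- A nonzero integer and its negative have different constructors, so the other cases are
    -- absurd.
    x≡-x⇒x≡0 {+ zero} _ = refl

  -- Off the diagonal `Q` agrees with `I q +ₘ Q`, a block of a matrix of signs.
  Q-off-diag : ∀ {i j} → i ≢ j → IsSign (Q i j)
  Q-off-diag {i} {j} i≢j =
    subst IsSign (trans (cong (ℤ._+ Q i j) (I-off-diag i≢j)) (ℤ.+-identityˡ _))
          (plusMinusOne (suc i) (suc j))

  -- Row `suc i` of the Hadamard matrix is orthogonal to its all-ones top row: the border
  -- contributes -1, and the row of `I q +ₘ Q` contributes 1 plus the row sum of `Q`.
  Q-row-sum : ∀ i → sum (Q i) ≡ 0ℤ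
  Q-row-sum i = cancel (sum (Q i)) (begin
    -1ℤ ℤ.+ (1ℤ ℤ.+ sum (Q i))
      ≡⟨ cong (λ x → -1ℤ ℤ.+ (x ℤ.+ sum (Q i))) (sum-I i (λ _ → 1ℤ)) ⟨
    -1ℤ ℤ.+ (sum (λ k → I q i k ℤ.* 1ℤ) ℤ.+ sum (Q i))
      ≡⟨ cong (λ x → -1ℤ ℤ.+ x) (∑-distrib-+ (λ k → I q i k ℤ.* 1ℤ) (Q i)) ⟨
    -1ℤ ℤ.+ sum (λ k → I q i k ℤ.* 1ℤ ℤ.+ Q i k)
      ≡⟨ cong (λ x → -1ℤ ℤ.+ x) (sum-cong-≗ (λ k → times-one (I q i k) (Q i k))) ⟩
    -1ℤ ℤ.+ sum (λ k → (I q i k ℤ.+ Q i k) ℤ.* 1ℤ)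
      ≡⟨ orthogonal (suc i) zero ⟩
    + suc q ℤ.* 0ℤ
      ≡⟨ ℤ.*-zeroʳ (+ suc q) ⟩
    0ℤ ∎)
    where
    times-one : ∀ x y → x ℤ.* 1ℤ ℤ.+ y ≡ (x ℤ.+ y) ℤ.* 1ℤ
    times-one = solve-∀
    assoc : ∀ x → -1ℤ ℤ.+ (1ℤ ℤ.+ x) ≡ x
    assoc = solve-∀
    cancel : ∀ x → -1ℤ ℤ.+ (1ℤ ℤ.+ x) ≡ 0ℤ → x ≡ 0ℤ
    cancel x eq = trans (sym (assoc x)) eq

  J*Qᵀ : ∀ i j → (J q *ₘ Q ᵀ) i j ≡ 0ℤ
  J*Qᵀ i j = trans (sum-cong-≗ (λ k → ℤ.*-identityˡ (Q j k))) (Q-row-sum j)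

  -- In the lower right block of the Gram matrix the cross terms `Q ᵀ` and `Q` cancel by skew
  -- symmetry, leaving J + I + QQᵀ = (q + 1)I.
  Q*Qᵀ : Q *ₘ Q ᵀ ≈ₘ (+ q) · I q +ₘ -ₘ J q
  Q*Qᵀ i j = cancel (+ q) (I q i j) (Q i j) _ (begin
    1ℤ ℤ.+ ((I q i j ℤ.+ ℤ.- Q i j) ℤ.+ (Q i j ℤ.+ (Q *ₘ Q ᵀ) i j))
      ≡⟨ cong (λ x → 1ℤ ℤ.+ x) (cong₂ ℤ._+_
           (cong₂ ℤ._+_ (*ₘ-identityʳ-ᵀ (I q) i j) (trans (*ₘ-identityˡ (Q ᵀ) i j) (Q-skew i j)))
           (cong (ℤ._+ (Q *ₘ Q ᵀ) i j) (*ₘ-identityʳ-ᵀ Q i j))) ⟨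
    1ℤ ℤ.+ ((I q *ₘ I q ᵀ +ₘ I q *ₘ Q ᵀ) +ₘ (Q *ₘ I q ᵀ +ₘ Q *ₘ Q ᵀ)) i j
      ≡⟨ cong (λ x → 1ℤ ℤ.+ x) (*ₘ-expand (I q) Q (I q ᵀ) (Q ᵀ) i j) ⟨
    1ℤ ℤ.+ ((I q +ₘ Q) *ₘ (I q +ₘ Q) ᵀ) i j
      -- The leading `1ℤ` is the product (-1)(-1) of the border entries of the two rows.
      ≡⟨ orthogonal (suc i) (suc j) ⟩
    (1ℤ ℤ.+ + q) ℤ.* I q i j ∎)
    where
    isolate : ∀ e x g →
      g ≡ (1ℤ ℤ.+ ((e ℤ.+ ℤ.- x) ℤ.+ (x ℤ.+ g))) ℤ.+ (ℤ.- 1ℤ ℤ.+ ℤ.- e)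
    isolate = solve-∀
    simplify : ∀ c e → (1ℤ ℤ.+ c) ℤ.* e ℤ.+ (ℤ.- 1ℤ ℤ.+ ℤ.- e) ≡ c ℤ.* e ℤ.+ ℤ.- 1ℤ
    simplify = solve-∀
    cancel : ∀ c e x g →
      1ℤ ℤ.+ ((e ℤ.+ ℤ.- x) ℤ.+ (x ℤ.+ g)) ≡ (1ℤ ℤ.+ c) ℤ.* e → g ≡ c ℤ.* e ℤ.+ ℤ.- 1ℤ
    cancel c e x g eq =
      trans (isolate e x g) (trans (cong (ℤ._+ (ℤ.- 1ℤ ℤ.+ ℤ.- e)) eq) (simplify c e))

  -- One step of the recursion

  module Step {n : ℕ} (X Y : Matrix n n) where

    X′ Y′ : Matrix (q * n) (q * n)
    X′ = J q ⊗ Y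
    Y′ = I q ⊗ X +ₘ Q ⊗ Y

    private
      quo : Fin (q * n) → Fin q
      quo = quotient n
      rem : Fin (q * n) → Fin n
      rem = remainder {q} n

    X′-plusMinusOne : PlusMinusOne Y → PlusMinusOne X′
    X′-plusMinusOne Y± i j = *-isSign (inj₁ refl) (Y± (rem i) (rem j))

    -- The two summands have disjoint supports: diagonal blocks are copies of `X`, and every other
    -- block is `Y` up to sign.
    Y′-plusMinusOne : PlusMinusOne X → PlusMinusOne Y → PlusMinusOne Y′
    Y′-plusMinusOne X± Y± i j with quo i ≟ quo j
    ... | yes a≡c = subst IsSign
      (sym (trans (cong (λ x → 1ℤ ℤ.* X b d ℤ.+ x ℤ.* Y b d) Q≡0) (only-X (X b d) (Y b d))))
      (X± b d)
      where
      b = rem i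
      d = rem j
      Q≡0 : Q (quo i) (quo j) ≡ 0ℤ
      Q≡0 = trans (cong (Q (quo i)) (sym a≡c)) (Q-diag (quo i))
      only-X : ∀ x y → 1ℤ ℤ.* x ℤ.+ 0ℤ ℤ.* y ≡ x
      only-X = solve-∀
    ... | no a≢c = subst IsSign (sym (ℤ.+-identityˡ _))
      (*-isSign (Q-off-diag a≢c) (Y± (rem i) (rem j)))

    X′*X′ᵀ : X′ *ₘ X′ ᵀ ≈ₘ (+ q) · (J q ⊗ (Y *ₘ Y ᵀ))
    X′*X′ᵀ i j = begin
      (X′ *ₘ X′ ᵀ) i j
        ≡⟨ ⊗-*ₘ-⊗ (J q) Y (J q ᵀ) (Y ᵀ) i j ⟩
      sum {q} (λ _ → 1ℤ) ℤ.* (Y *ₘ Y ᵀ) (rem i) (rem j)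
        ≡⟨ cong₂ ℤ._*_ (sum-ones q) (sym (ℤ.*-identityˡ _)) ⟩
      + q ℤ.* (1ℤ ℤ.* (Y *ₘ Y ᵀ) (rem i) (rem j)) ∎

    -- The contribution of `Q ⊗ Y` vanishes because the rows of `Q` sum to zero.
    X′*Y′ᵀ : X′ *ₘ Y′ ᵀ ≈ₘ J q ⊗ (Y *ₘ X ᵀ)
    X′*Y′ᵀ i j = begin
      (X′ *ₘ Y′ ᵀ) i j
        ≡⟨ *ₘ-distribˡ-+ₘ X′ (I q ᵀ ⊗ X ᵀ) (Q ᵀ ⊗ Y ᵀ) i j ⟩
      (X′ *ₘ (I q ᵀ ⊗ X ᵀ) +ₘ X′ *ₘ (Q ᵀ ⊗ Y ᵀ)) i j
        ≡⟨ cong₂ ℤ._+_ (⊗-*ₘ-⊗ (J q) Y (I q ᵀ) (X ᵀ) i j) (⊗-*ₘ-⊗ (J q) Y (Q ᵀ) (Y ᵀ) i j) ⟩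
      ((J q *ₘ I q ᵀ) ⊗ (Y *ₘ X ᵀ) +ₘ (J q *ₘ Q ᵀ) ⊗ (Y *ₘ Y ᵀ)) i j
        ≡⟨ cong₂ (λ x y → x ℤ.* (Y *ₘ X ᵀ) (rem i) (rem j) ℤ.+ y ℤ.* (Y *ₘ Y ᵀ) (rem i) (rem j))
             (*ₘ-identityʳ-ᵀ (J q) (quo i) (quo j)) (J*Qᵀ (quo i) (quo j)) ⟩
      1ℤ ℤ.* (Y *ₘ X ᵀ) (rem i) (rem j) ℤ.+ 0ℤ
        ≡⟨ ℤ.+-identityʳ _ ⟩
      (J q ⊗ (Y *ₘ X ᵀ)) i j ∎

    -- Amicability of `X` and `Y` makes `Y *ₘ X ᵀ` symmetric, hence also `J q ⊗ (Y *ₘ X ᵀ)`, which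
    -- is `X′ *ₘ Y′ ᵀ`.
    X′-Y′-amicable : Amicable X Y → Amicable X′ Y′
    X′-Y′-amicable amic i j = begin
      (X′ *ₘ Y′ ᵀ) i j                  ≡⟨ X′*Y′ᵀ i j ⟩
      1ℤ ℤ.* (Y *ₘ X ᵀ) (rem i) (rem j) ≡⟨ cong (λ x → 1ℤ ℤ.* x) (*ₘ-ᵀ-swap Y X (rem i) (rem j)) ⟩
      1ℤ ℤ.* (X *ₘ Y ᵀ) (rem j) (rem i) ≡⟨ cong (λ x → 1ℤ ℤ.* x) (amic (rem j) (rem i)) ⟩
      1ℤ ℤ.* (Y *ₘ X ᵀ) (rem j) (rem i) ≡⟨ X′*Y′ᵀ j i ⟨
      (X′ *ₘ Y′ ᵀ) j i                  ≡⟨ *ₘ-ᵀ-swap Y′ X′ i j ⟨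
      (Y′ *ₘ X′ ᵀ) i j                  ∎

    Y′*Y′ᵀ : Amicable X Y →
             Y′ *ₘ Y′ ᵀ ≈ₘ I q ⊗ (X *ₘ X ᵀ) +ₘ ((+ q) · I q +ₘ -ₘ J q) ⊗ (Y *ₘ Y ᵀ)
    Y′*Y′ᵀ amic i j = begin
      (Y′ *ₘ Y′ ᵀ) i j
        ≡⟨ *ₘ-expand (I q ⊗ X) (Q ⊗ Y) (I q ᵀ ⊗ X ᵀ) (Q ᵀ ⊗ Y ᵀ) i j ⟩
      (((I q ⊗ X) *ₘ (I q ᵀ ⊗ X ᵀ) +ₘ (I q ⊗ X) *ₘ (Q ᵀ ⊗ Y ᵀ)) +ₘ
       ((Q ⊗ Y) *ₘ (I q ᵀ ⊗ X ᵀ) +ₘ (Q ⊗ Y) *ₘ (Q ᵀ ⊗ Y ᵀ))) i j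
        ≡⟨ cong₂ ℤ._+_
             (cong₂ ℤ._+_
               (trans (⊗-*ₘ-⊗ (I q) X (I q ᵀ) (X ᵀ) i j)
                      (cong (ℤ._* (X *ₘ X ᵀ) b d) (*ₘ-identityʳ-ᵀ (I q) a c)))
               -- Skew symmetry turns `Q ᵀ` into the negative of `Q`, and amicability turns
               -- `X *ₘ Y ᵀ` into `Y *ₘ X ᵀ`, so this term becomes the negative of the next one.
               (trans (⊗-*ₘ-⊗ (I q) X (Q ᵀ) (Y ᵀ) i j)
                      (cong₂ ℤ._*_ (trans (*ₘ-identityˡ (Q ᵀ) a c) (Q-skew a c)) (amic b d))))
             (cong₂ ℤ._+_
               (trans (⊗-*ₘ-⊗ Q Y (I q ᵀ) (X ᵀ) i j)
                      (cong (ℤ._* (Y *ₘ X ᵀ) b d) (*ₘ-identityʳ-ᵀ Q a c)))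
               (trans (⊗-*ₘ-⊗ Q Y (Q ᵀ) (Y ᵀ) i j)
                      (cong (ℤ._* (Y *ₘ Y ᵀ) b d) (Q*Qᵀ a c)))) ⟩
      (I q a c ℤ.* (X *ₘ X ᵀ) b d ℤ.+ ℤ.- Q a c ℤ.* (Y *ₘ X ᵀ) b d) ℤ.+
      (Q a c ℤ.* (Y *ₘ X ᵀ) b d ℤ.+ (+ q ℤ.* I q a c ℤ.+ -1ℤ) ℤ.* (Y *ₘ Y ᵀ) b d)
        ≡⟨ cross-terms-cancel (I q a c ℤ.* (X *ₘ X ᵀ) b d) (Q a c) ((Y *ₘ X ᵀ) b d) _ ⟩
      (I q ⊗ (X *ₘ X ᵀ) +ₘ ((+ q) · I q +ₘ -ₘ J q) ⊗ (Y *ₘ Y ᵀ)) i j ∎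
      where
      a = quo i
      b = rem i
      c = quo j
      d = rem j
      cross-terms-cancel : ∀ u x y v → (u ℤ.+ ℤ.- x ℤ.* y) ℤ.+ (x ℤ.* y ℤ.+ v) ≡ u ℤ.+ v
      cross-terms-cancel = solve-∀

    X′-Y′-gram : ∀ {e} → Amicable X Y →
                 X *ₘ X ᵀ +ₘ (+ q) · (Y *ₘ Y ᵀ) ≈ₘ e · I n →
                 X′ *ₘ X′ ᵀ +ₘ (+ q) · (Y′ *ₘ Y′ ᵀ) ≈ₘ (+ q ℤ.* e) · I (q * n)
    X′-Y′-gram {e} amic gram i j = begin
      (X′ *ₘ X′ ᵀ) i j ℤ.+ + q ℤ.* (Y′ *ₘ Y′ ᵀ) i j
        ≡⟨ cong₂ (λ x y → x ℤ.+ + q ℤ.* y) (X′*X′ᵀ i j) (Y′*Y′ᵀ amic i j) ⟩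
      + q ℤ.* (1ℤ ℤ.* yy) ℤ.+ + q ℤ.* (ι ℤ.* xx ℤ.+ (+ q ℤ.* ι ℤ.+ -1ℤ) ℤ.* yy)
        -- The first `yy` term, from `X′`, cancels against the `-1ℤ` that is the entry of `-ₘ J q`;
        -- every remaining term carries the factor `ι`.
        ≡⟨ collect (+ q) ι xx yy ⟩
      + q ℤ.* (ι ℤ.* (xx ℤ.+ + q ℤ.* yy))
        ≡⟨ cong (λ x → + q ℤ.* (ι ℤ.* x)) (gram (rem i) (rem j)) ⟩
      + q ℤ.* (ι ℤ.* (e ℤ.* I n (rem i) (rem j)))
        ≡⟨ regroup (+ q) ι e (I n (rem i) (rem j)) ⟩
      (+ q ℤ.* e) ℤ.* (I q ⊗ I n) i j
        ≡⟨ cong (λ x → (+ q ℤ.* e) ℤ.* x) (I-⊗-I {q} {n} i j) ⟨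
      (+ q ℤ.* e) ℤ.* I (q * n) i j ∎
      where
      ι  = I q (quo i) (quo j)
      xx = (X *ₘ X ᵀ) (rem i) (rem j)
      yy = (Y *ₘ Y ᵀ) (rem i) (rem j)
      collect : ∀ c u x y →
        c ℤ.* (1ℤ ℤ.* y) ℤ.+ c ℤ.* (u ℤ.* x ℤ.+ (c ℤ.* u ℤ.+ -1ℤ) ℤ.* y) ≡ c ℤ.* (u ℤ.* (x ℤ.+ c ℤ.* y))
      collect = solve-∀
      regroup : ∀ c u f v → c ℤ.* (u ℤ.* (f ℤ.* v)) ≡ (c ℤ.* f) ℤ.* (u ℤ.* v)
      regroup = solve-∀

mainTheorem4 : (q : ℕ) (Q : Matrix q q) → SkewSymmetricCore Q → (m : ℕ) →
    PlusMinusOne (𝒥 Q m) × PlusMinusOne (𝒜 Q m) × Amicable (𝒥 Q m) (𝒜 Q m) ×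
    (𝒥 Q m *ₘ 𝒥 Q m ᵀ +ₘ (+ q) · (𝒜 Q m *ₘ 𝒜 Q m ᵀ) ≈ₘ (+ (q ^ m * (q + 1))) · I (q ^ m))
mainTheorem4 q Q core zero =
  (λ _ _ → inj₁ refl) , (λ _ _ → inj₁ refl) , (λ _ _ → refl) , λ where
    zero zero → begin
      -- Both matrices are the 1 by 1 matrix of ones, so the only entry of the left side is 1 + q.
      1ℤ ℤ.+ + q ℤ.* 1ℤ            ≡⟨ cong (λ x → 1ℤ ℤ.+ x) (ℤ.*-identityʳ (+ q)) ⟩
      + (1 + q)                    ≡⟨ cong +_ (trans (ℕ.+-comm 1 q) (sym (ℕ.*-identityˡ (q + 1)))) ⟩
      + (1 * (q + 1))              ≡⟨ ℤ.*-identityʳ _ ⟨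
      + (1 * (q + 1)) ℤ.* 1ℤ       ∎
mainTheorem4 q Q core (suc m) with mainTheorem4 q Q core m
... | 𝒥± , 𝒜± , amic , gram =
  X′-plusMinusOne 𝒜± , Y′-plusMinusOne 𝒥± 𝒜± , X′-Y′-amicable amic , λ i j →
    trans (X′-Y′-gram amic gram i j) (cong (ℤ._* I (q ^ suc m) i j) scale)
  where
  open Core.Step Q core (𝒥 Q m) (𝒜 Q m)
  -- Each step multiplies the scalar by q, which raises the power of q by one.
  scale : + q ℤ.* + (q ^ m * (q + 1)) ≡ + (q ^ suc m * (q + 1))
  scale = trans (sym (ℤ.pos-* q _)) (cong +_ (sym (ℕ.*-assoc q (q ^ m) (q + 1))))
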